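{- Let $\mathcal{V}$ be a strongly irregular variety of a plural type (possibly with constants). If $\mathcal{V}$ has epimorphism surjectivity, then its regularization $R(\mathcal{V})$ has epimorphism surjectivity.
   Context: A type is plural if it contains at least one operation symbol of arity at least $2$. An identity is regular if the same variables occur on both sides. A variety $\mathcal{V}$ is strongly irregular if there is a binary term $f(x,y)$, in which both variables actually occur, such that $\mathcal{V}\models f(x,y)\approx x$. $R(\mathcal{V})$ is the variety (of the same type) defined by all regular identities holding in $\mathcal{V}$. For a class $\mathcal{K}$ of similar algebras, a homomorphism $f\colon\mathbf{A}\to\mathbf{B}$ with $\mathbf{A},\mathbf{B}\in\mathcal{K}$ is a $\mathcal{K}$-epimorphism if for every $\mathbf{C}\in\mathcal{K}$ and all homomorphisms $g_1,g_2\colon\mathbf{B}\to\mathbf{C}$, $g_1\circ f=g_2\circ f$ implies $g_1=g_2$. $\mathcal{K}$ has epimorphism surjectivity if every $\mathcal{K}$-epimorphism is surjective. -}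

module Defs where

open import Data.Fin.Base using (Fin; zero; suc)
open import Data.Nat.Base using (ℕ; _≤_)
open import Data.Product.Base using (∃-syntax; Σ-syntax; _×_)
open import Function.Base using (_∘_)
open import Function.Bundles using (Func; _⇔_)
open import Function.Definitions using (Surjective)
open import Level using (Level; _⊔_) renaming (suc to lsuc)
open import Relation.Binary.Bundles using (Setoid)
open import Relation.Unary using (Pred; _∈_; _≐_)

record Signature (o : Level) : Set (lsuc o) where
  field
    Op    : Set o
    arity : Op → ℕ

open Signature public

Plural : {o : Level} → Signature o → Set o
Plural 𝑆 = ∃[ ω ] 2 ≤ arity 𝑆 ω

data Term {o x : Level} (𝑆 : Signature o) (X : Set x) : Set (o ⊔ x) where
  var : X → Term 𝑆 X
  op  : (ω : Op 𝑆) → (Fin (arity 𝑆 ω) → Term 𝑆 X) → Term 𝑆 X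

data Occurs {o x : Level} {𝑆 : Signature o} {X : Set x} (v : X) : Term 𝑆 X → Set (o ⊔ x) where
  here  : Occurs v (var v)
  there : {ω : Op 𝑆} {ts : Fin (arity 𝑆 ω) → Term 𝑆 X} (i : Fin (arity 𝑆 ω)) →
          Occurs v (ts i) → Occurs v (op ω ts)

Regular : {o x : Level} {𝑆 : Signature o} {X : Set x} → Term 𝑆 X → Term 𝑆 X → Set (o ⊔ x)
Regular {X = X} p q = (v : X) → Occurs v p ⇔ Occurs v q

-- The carrier is a setoid, so that quotients of algebras are available. As is
-- usual in universal algebra, algebras are non-empty; the chosen inhabitant
-- need not be preserved by homomorphisms.
record Algebra {o : Level} (𝑆 : Signature o) (ℓ : Level) : Set (o ⊔ lsuc ℓ) where
  field
    setoid : Setoid ℓ ℓ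

  open Setoid setoid public

  field
    inhabitant  : Carrier
    interp      : (ω : Op 𝑆) → (Fin (arity 𝑆 ω) → Carrier) → Carrier
    interp-cong : (ω : Op 𝑆) {u v : Fin (arity 𝑆 ω) → Carrier} →
                  (∀ i → u i ≈ v i) → interp ω u ≈ interp ω v

open Algebra using (setoid; Carrier)

module _ {o ℓ : Level} {𝑆 : Signature o} where

  eval : {x : Level} {X : Set x} (𝐀 : Algebra 𝑆 ℓ) → (X → Carrier 𝐀) → Term 𝑆 X → Carrier 𝐀
  eval 𝐀 η (var v)   = η v
  eval 𝐀 η (op ω ts) = Algebra.interp 𝐀 ω (λ i → eval 𝐀 η (ts i))

  infix 4 _⊨_≈_ _⊫_≈_

  _⊨_≈_ : {x : Level} {X : Set x} → Algebra 𝑆 ℓ → Term 𝑆 X → Term 𝑆 X → Set (x ⊔ ℓ)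
  _⊨_≈_ {X = X} 𝐀 p q = (η : X → Carrier 𝐀) → eval 𝐀 η p ≈ eval 𝐀 η q
    where open Algebra 𝐀 using (_≈_)

  _⊫_≈_ : {κ x : Level} {X : Set x} → Pred (Algebra 𝑆 ℓ) κ → Term 𝑆 X → Term 𝑆 X →
          Set (o ⊔ lsuc ℓ ⊔ κ ⊔ x)
  𝒦 ⊫ p ≈ q = (𝐀 : Algebra 𝑆 ℓ) → 𝐀 ∈ 𝒦 → 𝐀 ⊨ p ≈ q

  -- Sets of identities are given over the countable set of variables ℕ.
  Mod : {e : Level} → (Term 𝑆 ℕ → Term 𝑆 ℕ → Set e) → Pred (Algebra 𝑆 ℓ) (o ⊔ ℓ ⊔ e)
  Mod E 𝐀 = (p q : Term 𝑆 ℕ) → E p q → 𝐀 ⊨ p ≈ q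

  IsVariety : {κ : Level} (e : Level) → Pred (Algebra 𝑆 ℓ) κ → Set (o ⊔ lsuc ℓ ⊔ κ ⊔ lsuc e)
  IsVariety e 𝒱 = Σ[ E ∈ (Term 𝑆 ℕ → Term 𝑆 ℕ → Set e) ] (𝒱 ≐ Mod E)

  StronglyIrregular : {κ : Level} → Pred (Algebra 𝑆 ℓ) κ → Set (o ⊔ lsuc ℓ ⊔ κ)
  StronglyIrregular 𝒱 =
    Σ[ f ∈ Term 𝑆 (Fin 2) ]
      Occurs zero f × Occurs (suc zero) f × (𝒱 ⊫ f ≈ var zero)

  R : {κ : Level} → Pred (Algebra 𝑆 ℓ) κ → Pred (Algebra 𝑆 ℓ) (o ⊔ lsuc ℓ ⊔ κ)
  R 𝒱 = Mod (λ p q → Regular p q × (𝒱 ⊫ p ≈ q))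

  record Hom (𝐀 𝐁 : Algebra 𝑆 ℓ) : Set (o ⊔ ℓ) where
    private
      module A = Algebra 𝐀
      module B = Algebra 𝐁

    field
      func : Func A.setoid B.setoid

    open Func func public using (to; cong)

    field
      homo : (ω : Op 𝑆) (u : Fin (arity 𝑆 ω) → A.Carrier) →
             to (A.interp ω u) B.≈ B.interp ω (to ∘ u)

  open Hom using (to)

  IsEpimorphism : {κ : Level} (𝒦 : Pred (Algebra 𝑆 ℓ) κ) {𝐀 𝐁 : Algebra 𝑆 ℓ} →
                  Hom 𝐀 𝐁 → Set (o ⊔ lsuc ℓ ⊔ κ)
  IsEpimorphism 𝒦 {𝐀} {𝐁} f =
    (𝐂 : Algebra 𝑆 ℓ) → 𝐂 ∈ 𝒦 → (g₁ g₂ : Hom 𝐁 𝐂) →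
    let open Algebra 𝐂 using (_≈_) in
    ((a : Carrier 𝐀) → to g₁ (to f a) ≈ to g₂ (to f a)) →
    (b : Carrier 𝐁) → to g₁ b ≈ to g₂ b

  IsSurjective : {𝐀 𝐁 : Algebra 𝑆 ℓ} → Hom 𝐀 𝐁 → Set ℓ
  IsSurjective {𝐀} {𝐁} f = Surjective (Algebra._≈_ 𝐀) (Algebra._≈_ 𝐁) (to f)

  EpimorphismSurjectivity : {κ : Level} → Pred (Algebra 𝑆 ℓ) κ → Set (o ⊔ lsuc ℓ ⊔ κ)
  EpimorphismSurjectivity 𝒦 =
    (𝐀 𝐁 : Algebra 𝑆 ℓ) → 𝐀 ∈ 𝒦 → 𝐁 ∈ 𝒦 → (f : Hom 𝐀 𝐁) →
    IsEpimorphism 𝒦 f → IsSurjective f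

{-# OPTIONS --safe #-}

-- Write x ∙ y for the term witnessing strong irregularity. In an algebra 𝐁 of
-- R 𝒱 the relation "b ⊑ y iff y ∙ b ≈ y" is the preorder whose quotient indexes
-- the Płonka decomposition of 𝐁. Let f : 𝐀 → 𝐁 be an epimorphism and b ∈ 𝐁.
--
-- The maps c ↦ [c ⊑ b] and c ↦ [∃ a. c ⊑ f a ⊑ b] are homomorphisms into truth
-- values with conjunction, and they agree on the image of f; so they agree at b,
-- which provides a₀ such that x = f a₀ lies in the Płonka fibre of b.
--
-- The fibre of x is {c | c ⊑ x} modulo c ∙ x ≈ c′ ∙ x, and it belongs to 𝒱. Two
-- homomorphisms from it to 𝐂 ∈ 𝒱 extend to homomorphisms from 𝐁 to an algebra of
-- partial elements of 𝐂, defined at c only if c ⊑ x. So the part of the image of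
-- f in the fibre embeds 𝒱-epimorphically into it, hence is the whole fibre.
module Submission where

open import Defs
open import Data.Fin.Base using (Fin; zero; suc; toℕ)
open import Data.Fin.Properties using (any?)
open import Data.Nat.Base using (ℕ; zero; suc)
open import Data.Nat.Properties using (_≟_)
open import Data.Product.Base using (Σ-syntax; ∃-syntax; _×_; _,_; proj₁; proj₂)
open import Data.Sum.Base using (_⊎_; inj₁; inj₂; [_,_])
open import Data.Vec.Functional using ([]; _∷_)
open import Function.Base using (id; _∘_)
open import Function.Bundles using (Equivalence; _⇔_; mk⇔)
open import Function.Properties.Equivalence using (⇔-setoid)
open import Level using (Level)
import Relation.Binary.Construct.On as On
open import Relation.Binary.PropositionalEquality as ≡ using (_≡_)
import Relation.Binary.Reasoning.Setoid as SetoidReasoning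
open import Relation.Nullary.Decidable using (Dec; yes; no; map′)
open import Relation.Nullary.Negation using (contradiction)
open import Relation.Unary using (Pred; _∈_)

open Algebra using (Carrier)
open Hom using (to)

private
  variable
    o ℓ κ e x y : Level
    𝑆 : Signature o
    X : Set x
    Y : Set y

-- Substitution and occurrence of variables.

infixl 8 _⟪_⟫

_⟪_⟫ : Term 𝑆 X → (X → Term 𝑆 Y) → Term 𝑆 Y
var v   ⟪ σ ⟫ = σ v
op ω ts ⟪ σ ⟫ = op ω (λ i → ts i ⟪ σ ⟫)

occurs-⟪⟫⁺ : {t : Term 𝑆 X} {σ : X → Term 𝑆 Y} {v : X} {w : Y} →
             Occurs v t → Occurs w (σ v) → Occurs w (t ⟪ σ ⟫)
occurs-⟪⟫⁺ here        w∈ = w∈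
occurs-⟪⟫⁺ (there i p) w∈ = there i (occurs-⟪⟫⁺ p w∈)

occurs-⟪⟫⁻ : (t : Term 𝑆 X) {σ : X → Term 𝑆 Y} {w : Y} →
             Occurs w (t ⟪ σ ⟫) → ∃[ v ] Occurs v t × Occurs w (σ v)
occurs-⟪⟫⁻ (var v)   w∈          = v , here , w∈
occurs-⟪⟫⁻ (op ω ts) (there i p) with occurs-⟪⟫⁻ (ts i) p
... | v , v∈ , w∈ = v , there i v∈ , w∈

occurs? : (v : ℕ) (t : Term 𝑆 ℕ) → Dec (Occurs v t)
occurs? v (var w)   = map′ (λ { ≡.refl → here }) (λ { here → ≡.refl }) (v ≟ w)
occurs? v (op ω ts) = map′ (λ (i , p) → there i p) (λ { (there i p) → i , p })
                           (any? (λ i → occurs? v (ts i)))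

-- A left inverse of `toℕ`: composing with it extends an assignment of finitely many variables to
-- all of `ℕ`.
clamp : (n : ℕ) → ℕ → Fin (suc n)
clamp n       zero    = zero
clamp zero    (suc v) = zero
clamp (suc n) (suc v) = suc (clamp n v)

clamp-toℕ : {n : ℕ} (i : Fin (suc n)) → clamp n (toℕ i) ≡ i
clamp-toℕ             zero    = ≡.refl
clamp-toℕ {n = suc n} (suc i) = ≡.cong suc (clamp-toℕ i)

module _ {o ℓ : Level} {𝑆 : Signature o} where

  -- Evaluation of terms.

  module _ (𝐀 : Algebra 𝑆 ℓ) where
    open Algebra 𝐀 hiding (Carrier)

    eval-cong : {η θ : X → Carrier 𝐀} (t : Term 𝑆 X) →
                (∀ v → Occurs v t → η v ≈ θ v) → eval 𝐀 η t ≈ eval 𝐀 θ t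
    eval-cong (var v)   η≈θ = η≈θ v here
    eval-cong (op ω ts) η≈θ =
      interp-cong ω (λ i → eval-cong (ts i) (λ v v∈ → η≈θ v (there i v∈)))

    eval-⟪⟫ : {η : Y → Carrier 𝐀} {σ : X → Term 𝑆 Y} (t : Term 𝑆 X) →
              eval 𝐀 η (t ⟪ σ ⟫) ≈ eval 𝐀 (λ v → eval 𝐀 η (σ v)) t
    eval-⟪⟫ (var v)   = refl
    eval-⟪⟫ (op ω ts) = interp-cong ω (λ i → eval-⟪⟫ (ts i))

  -- `h` need not respect equality: the projection of a fibre to `𝐁` in general does not, since
  -- equality in a fibre is coarser.
  eval-homo : (𝐀 𝐁 : Algebra 𝑆 ℓ) (h : Carrier 𝐀 → Carrier 𝐁) →
              let open Algebra 𝐁 using (_≈_; interp) in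
              (∀ ω u → h (Algebra.interp 𝐀 ω u) ≈ interp ω (h ∘ u)) →
              {η : X → Carrier 𝐀} (t : Term 𝑆 X) →
              h (eval 𝐀 η t) ≈ eval 𝐁 (h ∘ η) t
  eval-homo 𝐀 𝐁 h homo (var v)   = Algebra.refl 𝐁
  eval-homo 𝐀 𝐁 h homo (op ω ts) =
    Algebra.trans 𝐁 (homo ω _) (Algebra.interp-cong 𝐁 ω (λ i → eval-homo 𝐀 𝐁 h homo (ts i)))

  idHom : (𝐀 : Algebra 𝑆 ℓ) → Hom 𝐀 𝐀
  idHom 𝐀 = record
    { func = record { to = id ; cong = id }
    ; homo = λ _ _ → Algebra.refl 𝐀
    }

  -- Trees of truth values under conjunction stand for the semilattice of all
  -- truth values, which is too large to be the carrier of an Algebra 𝑆 ℓ.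
  data Tree (T : Set ℓ) : Set ℓ where
    leaf : T → Tree T
    node : (n : ℕ) → (Fin n → Tree T) → Tree T

  ⟦_⟧ : {T : Set ℓ} → Tree T → (T → Set ℓ) → Set ℓ
  ⟦ leaf t ⟧    M = M t
  ⟦ node n ts ⟧ M = (i : Fin n) → ⟦ ts i ⟧ M

  treeAlgebra : {T : Set ℓ} → (T → Set ℓ) → Algebra 𝑆 ℓ
  treeAlgebra M = record
    { setoid      = On.setoid (⇔-setoid ℓ) (λ t → ⟦ t ⟧ M)
    ; inhabitant  = node 0 (λ ())
    ; interp      = λ ω → node (arity 𝑆 ω)
    ; interp-cong = λ ω u⇔v → mk⇔ (λ h i → Equivalence.to (u⇔v i) (h i))
                                  (λ h i → Equivalence.from (u⇔v i) (h i))
    }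

  module _ {T : Set ℓ} (M : T → Set ℓ) {η : X → Tree T} where

    eval-tree⁺ : (t : Term 𝑆 X) → (∀ v → Occurs v t → ⟦ η v ⟧ M) →
                 ⟦ eval (treeAlgebra M) η t ⟧ M
    eval-tree⁺ (var v)   h   = h v here
    eval-tree⁺ (op ω ts) h i = eval-tree⁺ (ts i) (λ v v∈ → h v (there i v∈))

    eval-tree⁻ : {t : Term 𝑆 X} → ⟦ eval (treeAlgebra M) η t ⟧ M →
                 {v : X} → Occurs v t → ⟦ η v ⟧ M
    eval-tree⁻ h here         = h
    eval-tree⁻ h (there i v∈) = eval-tree⁻ (h i) v∈

  -- A term evaluates to the conjunction of the truth values at its variables, so only the set of
  -- occurring variables matters.
  treeAlgebra∈R : {T : Set ℓ} (M : T → Set ℓ) (𝒱 : Pred (Algebra 𝑆 ℓ) κ) → treeAlgebra M ∈ R 𝒱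
  treeAlgebra∈R M 𝒱 p q (reg , _) η = mk⇔
    (λ h → eval-tree⁺ M q (λ v v∈ → eval-tree⁻ M h (Equivalence.from (reg v) v∈)))
    (λ h → eval-tree⁺ M p (λ v v∈ → eval-tree⁻ M h (Equivalence.to (reg v) v∈)))

  -- Since every variable occurs on both sides, renaming along `toℕ` gives a regular identity over
  -- `ℕ`.
  R-full-identity : {𝒱 : Pred (Algebra 𝑆 ℓ) κ} {n : ℕ} (p q : Term 𝑆 (Fin (suc n))) →
                    (∀ v → Occurs v p) → (∀ v → Occurs v q) → 𝒱 ⊫ p ≈ q → R 𝒱 ⊫ p ≈ q
  R-full-identity {𝒱 = 𝒱} {n} p q p-full q-full 𝒱⊫p≈q 𝐁 𝐁∈R η = begin
    eval 𝐁 η p                          ≈⟨ eval-extend p ⟨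
    eval 𝐁 (η ∘ clamp n) (rename p)     ≈⟨ 𝐁∈R (rename p) (rename q) (reg , valid) _ ⟩
    eval 𝐁 (η ∘ clamp n) (rename q)     ≈⟨ eval-extend q ⟩
    eval 𝐁 η q                          ∎
    where
    open Algebra 𝐁 using (_≈_; reflexive)
    open SetoidReasoning (Algebra.setoid 𝐁)
    rename : Term 𝑆 (Fin (suc n)) → Term 𝑆 ℕ
    rename t = t ⟪ var ∘ toℕ ⟫
    eval-extend : ∀ t → eval 𝐁 (η ∘ clamp n) (rename t) ≈ eval 𝐁 η t
    eval-extend t = Algebra.trans 𝐁 (eval-⟪⟫ 𝐁 t)
      (eval-cong 𝐁 t (λ v _ → reflexive (≡.cong η (clamp-toℕ v))))
    transport : ∀ s t → (∀ v → Occurs v t) → ∀ {v} → Occurs v (rename s) → Occurs v (rename t)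
    transport s t t-full v∈ with occurs-⟪⟫⁻ s v∈
    ... | w , _ , v∈w = occurs-⟪⟫⁺ (t-full w) v∈w
    reg : Regular (rename p) (rename q)
    reg v = mk⇔ (transport p q q-full) (transport q p p-full)
    valid : 𝒱 ⊫ rename p ≈ rename q
    valid 𝐂 𝐂∈𝒱 θ = Algebra.trans 𝐂 (eval-⟪⟫ 𝐂 p)
      (Algebra.trans 𝐂 (𝒱⊫p≈q 𝐂 𝐂∈𝒱 _) (Algebra.sym 𝐂 (eval-⟪⟫ 𝐂 q)))

  -- The binary term of strong irregularity.

  module Płonka {𝒱 : Pred (Algebra 𝑆 ℓ) κ} (m : Term 𝑆 (Fin 2))
                (x∈m : Occurs zero m) (y∈m : Occurs (suc zero) m)
                (𝒱⊫m≈x : 𝒱 ⊫ m ≈ var zero) where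

    infixl 7 _·_

    _·_ : Term 𝑆 X → Term 𝑆 X → Term 𝑆 X
    s · t = m ⟪ s ∷ t ∷ [] ⟫

    module _ {v : X} {s t : Term 𝑆 X} where

      occurs-·ˡ : Occurs v s → Occurs v (s · t)
      occurs-·ˡ = occurs-⟪⟫⁺ x∈m

      occurs-·ʳ : Occurs v t → Occurs v (s · t)
      occurs-·ʳ = occurs-⟪⟫⁺ y∈m

      occurs-·⁻ : Occurs v (s · t) → Occurs v s ⊎ Occurs v t
      occurs-·⁻ v∈ with occurs-⟪⟫⁻ m v∈
      ... | zero     , _ , v∈s = inj₁ v∈s
      ... | suc zero , _ , v∈t = inj₂ v∈t

    module Product (𝐀 : Algebra 𝑆 ℓ) where
      open Algebra 𝐀 hiding (Carrier)

      infixl 7 _∙_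

      _∙_ : Carrier 𝐀 → Carrier 𝐀 → Carrier 𝐀
      a ∙ b = eval 𝐀 (a ∷ b ∷ []) m

      ∙-cong : ∀ {a a′ b b′} → a ≈ a′ → b ≈ b′ → a ∙ b ≈ a′ ∙ b′
      ∙-cong a≈a′ b≈b′ = eval-cong 𝐀 m λ { zero _ → a≈a′ ; (suc zero) _ → b≈b′ }

      ∙-congˡ : ∀ {a b b′} → b ≈ b′ → a ∙ b ≈ a ∙ b′
      ∙-congˡ = ∙-cong refl

      ∙-congʳ : ∀ {a a′ b} → a ≈ a′ → a ∙ b ≈ a′ ∙ b
      ∙-congʳ a≈a′ = ∙-cong a≈a′ refl

      eval-· : {η : X → Carrier 𝐀} (s t : Term 𝑆 X) →
               eval 𝐀 η (s · t) ≈ eval 𝐀 η s ∙ eval 𝐀 η t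
      eval-· s t = trans (eval-⟪⟫ 𝐀 m) (eval-cong 𝐀 m
        λ { zero _ → refl ; (suc zero) _ → refl })

    𝒱-eval-· : (𝐂 : Algebra 𝑆 ℓ) → 𝐂 ∈ 𝒱 → {η : X → Carrier 𝐂} (s t : Term 𝑆 X) →
               let open Algebra 𝐂 using (_≈_) in eval 𝐂 η (s · t) ≈ eval 𝐂 η s
    𝒱-eval-· 𝐂 𝐂∈𝒱 s t = Algebra.trans 𝐂 (Product.eval-· 𝐂 s t) (𝒱⊫m≈x 𝐂 𝐂∈𝒱 _)

    -- The Płonka preorder.

    module Fibres (𝐁 : Algebra 𝑆 ℓ) (𝐁∈R : 𝐁 ∈ R 𝒱) where
      open Algebra 𝐁 hiding (Carrier)
      open Product 𝐁 public
      open SetoidReasoning setoid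

      infix 4 _⊑_

      _⊑_ : Carrier 𝐁 → Carrier 𝐁 → Set ℓ
      b ⊑ y = y ∙ b ≈ y

      ⊑-respˡ : ∀ {b b′ y} → b ≈ b′ → b ⊑ y → b′ ⊑ y
      ⊑-respˡ b≈b′ b⊑y = trans (∙-congˡ (sym b≈b′)) b⊑y

      module _ {y : Carrier 𝐁} {ω : Op 𝑆} {u : Fin (arity 𝑆 ω) → Carrier 𝐁} where

        private
          𝐲 : Term 𝑆 (Fin (suc (arity 𝑆 ω)))
          𝐲 = var zero
          𝐮 : Fin (arity 𝑆 ω) → Term 𝑆 (Fin (suc (arity 𝑆 ω)))
          𝐮 = var ∘ suc
          all-occur : ∀ v → Occurs v (𝐲 · op ω 𝐮)
          all-occur zero    = occurs-·ˡ here
          all-occur (suc i) = occurs-·ʳ (there i here)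

        -- Both sides contain `y` and every `u i`, and both reduce to `y` in `𝒱`.
        ∙-interp-∙ : y ∙ interp ω u ≈ y ∙ interp ω (λ i → y ∙ u i)
        ∙-interp-∙ = begin
          y ∙ interp ω u                                   ≈⟨ eval-· 𝐲 (op ω 𝐮) ⟨
          eval 𝐁 (y ∷ u) (𝐲 · op ω 𝐮)                      ≈⟨ identity 𝐁 𝐁∈R (y ∷ u) ⟩
          eval 𝐁 (y ∷ u) (𝐲 · op ω (λ i → 𝐲 · 𝐮 i))        ≈⟨ eval-· 𝐲 (op ω (λ i → 𝐲 · 𝐮 i)) ⟩
          y ∙ eval 𝐁 (y ∷ u) (op ω (λ i → 𝐲 · 𝐮 i))        ≈⟨ ∙-congˡ (interp-cong ω (λ i → eval-· 𝐲 (𝐮 i))) ⟩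
          y ∙ interp ω (λ i → y ∙ u i)                     ∎
          where
          identity : R 𝒱 ⊫ 𝐲 · op ω 𝐮 ≈ 𝐲 · op ω (λ i → 𝐲 · 𝐮 i)
          identity = R-full-identity _ _ all-occur
            (λ { zero → occurs-·ˡ here ; (suc i) → occurs-·ʳ (there i (occurs-·ʳ here)) })
            (λ 𝐂 𝐂∈𝒱 θ →
              Algebra.trans 𝐂 (𝒱-eval-· 𝐂 𝐂∈𝒱 𝐲 _) (Algebra.sym 𝐂 (𝒱-eval-· 𝐂 𝐂∈𝒱 𝐲 _)))

        -- In `𝒱` all right factors `y` drop out. This is what makes the operations of a fibre
        -- respect its equality.
        interp-∙ : interp ω u ∙ y ≈ interp ω (λ i → u i ∙ y) ∙ y
        interp-∙ = begin
          interp ω u ∙ y                                   ≈⟨ eval-· (op ω 𝐮) 𝐲 ⟨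
          eval 𝐁 (y ∷ u) (op ω 𝐮 · 𝐲)                      ≈⟨ identity 𝐁 𝐁∈R (y ∷ u) ⟩
          eval 𝐁 (y ∷ u) (op ω (λ i → 𝐮 i · 𝐲) · 𝐲)        ≈⟨ eval-· (op ω (λ i → 𝐮 i · 𝐲)) 𝐲 ⟩
          eval 𝐁 (y ∷ u) (op ω (λ i → 𝐮 i · 𝐲)) ∙ y        ≈⟨ ∙-congʳ (interp-cong ω (λ i → eval-· (𝐮 i) 𝐲)) ⟩
          interp ω (λ i → u i ∙ y) ∙ y                     ∎
          where
          identity : R 𝒱 ⊫ op ω 𝐮 · 𝐲 ≈ op ω (λ i → 𝐮 i · 𝐲) · 𝐲
          identity = R-full-identity _ _
            (λ { zero → occurs-·ʳ here ; (suc i) → occurs-·ˡ (there i here) })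
            (λ { zero → occurs-·ʳ here ; (suc i) → occurs-·ˡ (there i (occurs-·ˡ here)) })
            (λ 𝐂 𝐂∈𝒱 θ →
              Algebra.trans 𝐂 (𝒱-eval-· 𝐂 𝐂∈𝒱 (op ω 𝐮) 𝐲)
                (Algebra.trans 𝐂
                  (Algebra.interp-cong 𝐂 ω (λ i → Algebra.sym 𝐂 (𝒱-eval-· 𝐂 𝐂∈𝒱 (𝐮 i) 𝐲)))
                  (Algebra.sym 𝐂 (𝒱-eval-· 𝐂 𝐂∈𝒱 (op ω (λ i → 𝐮 i · 𝐲)) 𝐲))))

        -- `y` may be replaced by `y ∙ interp ω u`, which absorbs `u i` because `u i` already occurs
        -- in it.
        ⊑-arg : interp ω u ⊑ y → ∀ i → u i ⊑ y
        ⊑-arg ωu⊑y i = begin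
          y ∙ u i                                          ≈⟨ ∙-congʳ ωu⊑y ⟨
          y ∙ interp ω u ∙ u i                             ≈⟨ ∙-congʳ (eval-· 𝐲 (op ω 𝐮)) ⟨
          eval 𝐁 (y ∷ u) (𝐲 · op ω 𝐮) ∙ u i                ≈⟨ eval-· (𝐲 · op ω 𝐮) (𝐮 i) ⟨
          eval 𝐁 (y ∷ u) (𝐲 · op ω 𝐮 · 𝐮 i)                ≈⟨ identity 𝐁 𝐁∈R (y ∷ u) ⟩
          eval 𝐁 (y ∷ u) (𝐲 · op ω 𝐮)                      ≈⟨ eval-· 𝐲 (op ω 𝐮) ⟩
          y ∙ interp ω u                                   ≈⟨ ωu⊑y ⟩
          y                                                ∎
          where
          identity : R 𝒱 ⊫ 𝐲 · op ω 𝐮 · 𝐮 i ≈ 𝐲 · op ω 𝐮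
          identity = R-full-identity _ _ (λ v → occurs-·ˡ {t = 𝐮 i} (all-occur v)) all-occur
            (λ 𝐂 𝐂∈𝒱 θ → 𝒱-eval-· 𝐂 𝐂∈𝒱 (𝐲 · op ω 𝐮) (𝐮 i))

      -- The left factor `y` keeps the identity regular even if `ω` is a constant.
      interp-const-⊑ : ∀ {y} ω → interp ω (λ _ → y) ⊑ y
      interp-const-⊑ {y} ω = trans (sym (eval-· 𝐲 (op ω (λ _ → 𝐲)))) (identity 𝐁 𝐁∈R (λ _ → y))
        where
        𝐲 : Term 𝑆 (Fin 1)
        𝐲 = var zero
        identity : R 𝒱 ⊫ 𝐲 · op ω (λ _ → 𝐲) ≈ 𝐲
        identity = R-full-identity _ _ (λ { zero → occurs-·ˡ here ; (suc ()) }) (λ { zero → here ; (suc ()) })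
          (λ 𝐂 𝐂∈𝒱 θ → 𝒱-eval-· 𝐂 𝐂∈𝒱 𝐲 _)

      -- Together with `⊑-arg` this says that `ω` acts on the preorder as a finite join; constants
      -- are least elements.
      ⊑-interp : ∀ {y ω u} → (∀ i → u i ⊑ y) → interp ω u ⊑ y
      ⊑-interp {y} {ω} {u} u⊑y = begin
        y ∙ interp ω u                 ≈⟨ ∙-interp-∙ ⟩
        y ∙ interp ω (λ i → y ∙ u i)   ≈⟨ ∙-congˡ (interp-cong ω u⊑y) ⟩
        y ∙ interp ω (λ _ → y)         ≈⟨ interp-const-⊑ ω ⟩
        y                              ∎

      module _ {y : Carrier 𝐁} {η : X → Carrier 𝐁} where

        ⊑-eval⁺ : (t : Term 𝑆 X) → (∀ v → η v ⊑ y) → eval 𝐁 η t ⊑ y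
        ⊑-eval⁺ (var v)   η⊑y = η⊑y v
        ⊑-eval⁺ (op ω ts) η⊑y = ⊑-interp (λ i → ⊑-eval⁺ (ts i) η⊑y)

        ⊑-eval⁻ : {t : Term 𝑆 X} → eval 𝐁 η t ⊑ y → ∀ {v} → Occurs v t → η v ⊑ y
        ⊑-eval⁻ t⊑y here         = t⊑y
        ⊑-eval⁻ t⊑y (there i v∈) = ⊑-eval⁻ (⊑-arg t⊑y i) v∈

      -- By `b ⊑ c`, the element `c` equals `c ∙ b`, a value of `m` in which `b` occurs as second
      -- argument.
      ⊑-trans : ∀ {b c d} → b ⊑ c → c ⊑ d → b ⊑ d
      ⊑-trans b⊑c c⊑d = ⊑-eval⁻ (⊑-respˡ (sym b⊑c) c⊑d) y∈m

      ⊑-refl : ∀ {b} → b ⊑ b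
      ⊑-refl {b} = trans (sym (eval-· 𝐛 𝐛)) (identity 𝐁 𝐁∈R (λ _ → b))
        where
        𝐛 : Term 𝑆 (Fin 1)
        𝐛 = var zero
        identity : R 𝒱 ⊫ 𝐛 · 𝐛 ≈ 𝐛
        identity = R-full-identity _ _ (λ { zero → occurs-·ˡ here ; (suc ()) }) (λ { zero → here ; (suc ()) })
          (λ 𝐂 𝐂∈𝒱 θ → 𝒱-eval-· 𝐂 𝐂∈𝒱 𝐛 𝐛)

      -- The identity may be irregular. Each side is multiplied by `y` times the other side, which
      -- makes it regular; below `y` this extra factor collapses to `y`.
      𝒱-identity-∙ : (p q : Term 𝑆 ℕ) → 𝒱 ⊫ p ≈ q → {y : Carrier 𝐁} {η : ℕ → Carrier 𝐁} →
                     (∀ v → η v ⊑ y) → eval 𝐁 η p ∙ y ≈ eval 𝐁 η q ∙ y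
      𝒱-identity-∙ p q 𝒱⊫p≈q {y} {η} η⊑y = begin
        eval 𝐁 η p ∙ y                    ≈⟨ ∙-congˡ (⊑-eval⁺ q η⊑y) ⟨
        eval 𝐁 η p ∙ (y ∙ eval 𝐁 η q)     ≈⟨ eval-twist p q ⟨
        eval 𝐁 θ (twist p q)              ≈⟨ 𝐁∈R (twist p q) (twist q p) (reg , valid) θ ⟩
        eval 𝐁 θ (twist q p)              ≈⟨ eval-twist q p ⟩
        eval 𝐁 η q ∙ (y ∙ eval 𝐁 η p)     ≈⟨ ∙-congˡ (⊑-eval⁺ p η⊑y) ⟩
        eval 𝐁 η q ∙ y                    ∎
        where
        shift : Term 𝑆 ℕ → Term 𝑆 ℕ
        shift t = t ⟪ var ∘ suc ⟫
        -- Reduces to s in 𝒱, while its variables do not depend on the order of s and t.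
        twist : Term 𝑆 ℕ → Term 𝑆 ℕ → Term 𝑆 ℕ
        twist s t = shift s · (var 0 · shift t)
        θ : ℕ → Carrier 𝐁
        θ zero    = y
        θ (suc v) = η v
        eval-twist : ∀ s t → eval 𝐁 θ (twist s t) ≈ eval 𝐁 η s ∙ (y ∙ eval 𝐁 η t)
        eval-twist s t = trans (eval-· (shift s) (var 0 · shift t))
          (∙-cong (eval-⟪⟫ 𝐁 s) (trans (eval-· (var 0) (shift t)) (∙-congˡ (eval-⟪⟫ 𝐁 t))))
        occurs-twist : ∀ s t {v} → Occurs v (twist s t) → Occurs v (twist t s)
        occurs-twist s t v∈ with occurs-·⁻ v∈
        ... | inj₁ v∈s = occurs-·ʳ (occurs-·ʳ v∈s)
        ... | inj₂ v∈yt with occurs-·⁻ v∈yt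
        ...   | inj₁ v∈y = occurs-·ʳ (occurs-·ˡ v∈y)
        ...   | inj₂ v∈t = occurs-·ˡ v∈t
        reg : Regular (twist p q) (twist q p)
        reg v = mk⇔ (occurs-twist p q) (occurs-twist q p)
        valid : 𝒱 ⊫ twist p q ≈ twist q p
        valid 𝐂 𝐂∈𝒱 ζ = C.trans (𝒱-eval-· 𝐂 𝐂∈𝒱 (shift p) _) (C.trans (eval-⟪⟫ 𝐂 p)
          (C.trans (𝒱⊫p≈q 𝐂 𝐂∈𝒱 _)
            (C.sym (C.trans (𝒱-eval-· 𝐂 𝐂∈𝒱 (shift q) _) (eval-⟪⟫ 𝐂 q)))))
          where
          module C = Algebra 𝐂

      -- Fibres as algebras of `𝒱`.

      -- The identity of `𝐁` gives the whole fibre, a general `f` the part of it met by the image.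
      -- Elements stay in `𝐀` and are compared in `𝐁`, so preimages are at hand.
      fibre : {𝐀 : Algebra 𝑆 ℓ} (f : Hom 𝐀 𝐁) (y : Carrier 𝐁) (a₀ : Carrier 𝐀) →
              to f a₀ ⊑ y → Algebra 𝑆 ℓ
      fibre {𝐀} f y a₀ fa₀⊑y = record
        { setoid      = On.setoid {B = Σ[ a ∈ Carrier 𝐀 ] to f a ⊑ y} setoid (λ (a , _) → to f a ∙ y)
        ; inhabitant  = a₀ , fa₀⊑y
        ; interp      = λ ω u → Algebra.interp 𝐀 ω (proj₁ ∘ u) ,
                                ⊑-respˡ (sym (Hom.homo f ω _)) (⊑-interp (proj₂ ∘ u))
        ; interp-cong = λ ω {u} {v} u≈v → begin
            to f (Algebra.interp 𝐀 ω (proj₁ ∘ u)) ∙ y      ≈⟨ ∙-congʳ (Hom.homo f ω _) ⟩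
            interp ω (to f ∘ proj₁ ∘ u) ∙ y                ≈⟨ interp-∙ ⟩
            interp ω (λ i → to f (proj₁ (u i)) ∙ y) ∙ y    ≈⟨ ∙-congʳ (interp-cong ω u≈v) ⟩
            interp ω (λ i → to f (proj₁ (v i)) ∙ y) ∙ y    ≈⟨ interp-∙ ⟨
            interp ω (to f ∘ proj₁ ∘ v) ∙ y                ≈⟨ ∙-congʳ (Hom.homo f ω _) ⟨
            to f (Algebra.interp 𝐀 ω (proj₁ ∘ v)) ∙ y      ∎
        }

      fibre∈𝒱 : IsVariety e 𝒱 → {𝐀 : Algebra 𝑆 ℓ} (f : Hom 𝐀 𝐁) {y : Carrier 𝐁} {a₀ : Carrier 𝐀}
                (fa₀⊑y : to f a₀ ⊑ y) → fibre f y a₀ fa₀⊑y ∈ 𝒱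
      fibre∈𝒱 (E , 𝒱⊆Mod , Mod⊆𝒱) f {y} {a₀} fa₀⊑y = Mod⊆𝒱 λ p q Epq η → begin
        to f (proj₁ (eval 𝐋 η p)) ∙ y      ≈⟨ ∙-congʳ (eval-fibre p) ⟩
        eval 𝐁 (to f ∘ proj₁ ∘ η) p ∙ y    ≈⟨ 𝒱-identity-∙ p q (λ 𝐂 𝐂∈𝒱 → 𝒱⊆Mod 𝐂∈𝒱 p q Epq) (proj₂ ∘ η) ⟩
        eval 𝐁 (to f ∘ proj₁ ∘ η) q ∙ y    ≈⟨ ∙-congʳ (eval-fibre q) ⟨
        to f (proj₁ (eval 𝐋 η q)) ∙ y      ∎
        where
        𝐋 : Algebra 𝑆 ℓ
        𝐋 = fibre f y a₀ fa₀⊑y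
        eval-fibre : {η : ℕ → Carrier 𝐋} (t : Term 𝑆 ℕ) →
                     to f (proj₁ (eval 𝐋 η t)) ≈ eval 𝐁 (to f ∘ proj₁ ∘ η) t
        eval-fibre = eval-homo 𝐋 𝐁 (to f ∘ proj₁) (λ ω u → Hom.homo f ω (proj₁ ∘ u))

      -- Partial elements of an algebra of `𝒱`.

      -- Classically, an absorbing element adjoined to `𝐂` would be the value outside the domain;
      -- making the value conditional avoids deciding `⊑`. Taking the domain from a point of `𝐁`,
      -- not from an arbitrary proposition, keeps the carrier at level `ℓ`.
      record Partial (y : Carrier 𝐁) (𝐂 : Algebra 𝑆 ℓ) : Set ℓ where
        field
          point    : Carrier 𝐁
          value    : point ⊑ y → Carrier 𝐂
          constant : (h h′ : point ⊑ y) → Algebra._≈_ 𝐂 (value h) (value h′)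

      open Partial

      partialAlgebra : Carrier 𝐁 → Algebra 𝑆 ℓ → Algebra 𝑆 ℓ
      partialAlgebra y 𝐂 = record
        { setoid = record
          { Carrier = Partial y 𝐂
          ; _≈_     = λ d d′ → point d ≈ point d′ × (∀ h h′ → value d h C.≈ value d′ h′)
          ; isEquivalence = record
            { refl  = λ {d} → refl , constant d
            ; sym   = λ (p , v) → sym p , λ h h′ → C.sym (v h′ h)
            ; trans = λ (p , v) (p′ , v′) → trans p p′ ,
                λ h h″ → C.trans (v h (⊑-respˡ p h)) (v′ (⊑-respˡ p h) h″)
            }
          }
        ; inhabitant = record
          { point    = inhabitant
          ; value    = λ _ → C.inhabitant
          ; constant = λ _ _ → C.refl
          }
        ; interp = λ ω u → record
          { point    = interp ω (point ∘ u)
          ; value    = λ h → C.interp ω (λ i → value (u i) (⊑-arg h i))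
          ; constant = λ h h′ → C.interp-cong ω (λ i → constant (u i) _ _)
          }
        ; interp-cong = λ ω d≈d′ → interp-cong ω (proj₁ ∘ d≈d′) ,
            λ h h′ → C.interp-cong ω (λ i → proj₂ (d≈d′ i) _ _)
        }
        where module C = Algebra 𝐂

      -- Where `p` is defined, so are all its variables, which gives an assignment in `𝐂`. By
      -- regularity the same assignment serves `q`.
      partialAlgebra∈R : {y : Carrier 𝐁} {𝐂 : Algebra 𝑆 ℓ} → 𝐂 ∈ 𝒱 → partialAlgebra y 𝐂 ∈ R 𝒱
      partialAlgebra∈R {y} {𝐂} 𝐂∈𝒱 p q (reg , 𝒱⊫p≈q) η = pq , λ h h′ →
        C.trans (eval-value p _ h (θ-value h))
          (C.trans (𝒱⊫p≈q 𝐂 𝐂∈𝒱 (θ h))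
            (C.sym (eval-value q (θ h) h′ (λ v v∈q → θ-value h v (Equivalence.from (reg v) v∈q)))))
        where
        module C = Algebra 𝐂
        𝐃 : Algebra 𝑆 ℓ
        𝐃 = partialAlgebra y 𝐂
        eval-point : (t : Term 𝑆 ℕ) → point (eval 𝐃 η t) ≈ eval 𝐁 (point ∘ η) t
        eval-point = eval-homo 𝐃 𝐁 point (λ _ _ → refl)
        pq : point (eval 𝐃 η p) ≈ point (eval 𝐃 η q)
        pq = trans (eval-point p) (trans (𝐁∈R p q (reg , 𝒱⊫p≈q) _) (sym (eval-point q)))
        eval-value : (t : Term 𝑆 ℕ) (θ : ℕ → Carrier 𝐂) (h : point (eval 𝐃 η t) ⊑ y) →
                     (∀ v → Occurs v t → ∀ h′ → value (η v) h′ C.≈ θ v) →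
                     value (eval 𝐃 η t) h C.≈ eval 𝐂 θ t
        eval-value (var v)   θ h η≈θ = η≈θ v here h
        eval-value (op ω ts) θ h η≈θ = C.interp-cong ω
          (λ i → eval-value (ts i) θ (⊑-arg h i) (λ v v∈ → η≈θ v (there i v∈)))
        -- η need not be defined at a variable that does not occur in p.
        θ : point (eval 𝐃 η p) ⊑ y → ℕ → Carrier 𝐂
        θ h v with occurs? v p
        ... | yes v∈p = value (η v) (⊑-eval⁻ (⊑-respˡ (eval-point p) h) v∈p)
        ... | no  _   = C.inhabitant
        θ-value : ∀ h v → Occurs v p → ∀ h′ → value (η v) h′ C.≈ θ h v
        θ-value h v v∈p h′ with occurs? v p
        ... | yes _   = constant (η v) _ _
        ... | no  v∉p = contradiction v∈p v∉p

      -- Each `b` is its own point, so any two extensions can differ only in their values. Proofs of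
      -- `b ⊑ y` do not affect these, as equality in the fibre ignores them.
      extend : {y b₀ : Carrier 𝐁} {b₀⊑y : b₀ ⊑ y} {𝐂 : Algebra 𝑆 ℓ} →
               Hom (fibre (idHom 𝐁) y b₀ b₀⊑y) 𝐂 → Hom 𝐁 (partialAlgebra y 𝐂)
      extend {𝐂 = 𝐂} g = record
        { func = record
          { to   = λ b → record
            { point    = b
            ; value    = λ h → to g (b , h)
            ; constant = λ _ _ → Hom.cong g refl
            }
          ; cong = λ b≈b′ → b≈b′ , λ _ _ → Hom.cong g (∙-congʳ b≈b′)
          }
        ; homo = λ ω u → refl , λ _ _ → Algebra.trans 𝐂 (Hom.cong g refl) (Hom.homo g ω _)
        }

      truthHom : {T : Set ℓ} {M : T → Set ℓ} (j : Carrier 𝐁 → T) →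
                 (∀ {b c} → b ≈ c → M (j b) → M (j c)) →
                 (∀ ω u → M (j (interp ω u)) ⇔ (∀ i → M (j (u i)))) →
                 Hom 𝐁 (treeAlgebra M)
      truthHom j M-resp M-interp = record
        { func = record
          { to   = leaf ∘ j
          ; cong = λ b≈c → mk⇔ (M-resp b≈c) (M-resp (sym b≈c))
          }
        ; homo = M-interp
        }

      -- Surjectivity of epimorphisms.

      module _ {𝐀 : Algebra 𝑆 ℓ} (f : Hom 𝐀 𝐁) (f-epi : IsEpimorphism (R 𝒱) f) where

        private
          module A = Algebra 𝐀
          module F = Hom f

        image-meets-fibre : (b : Carrier 𝐁) → ∃[ a ] b ⊑ F.to a × F.to a ⊑ b
        image-meets-fibre b = Equivalence.to (f-epi (treeAlgebra M) (treeAlgebra∈R M 𝒱) g₁ g₂ agree b) ⊑-refl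
          where
          below below-image : Carrier 𝐁 → Set ℓ
          below c       = c ⊑ b
          below-image c = ∃[ a ] c ⊑ F.to a × F.to a ⊑ b
          -- The two predicates must take values in one algebra, hence labels from a disjoint sum.
          M : Carrier 𝐁 ⊎ Carrier 𝐁 → Set ℓ
          M = [ below , below-image ]
          g₁ g₂ : Hom 𝐁 (treeAlgebra M)
          g₁ = truthHom inj₁ ⊑-respˡ (λ ω u → mk⇔ ⊑-arg ⊑-interp)
          g₂ = truthHom inj₂ (λ b≈c (a , b⊑fa , fa⊑b) → a , ⊑-respˡ b≈c b⊑fa , fa⊑b) λ ω u → mk⇔
            (λ (a , ωu⊑fa , fa⊑b) i → a , ⊑-arg ωu⊑fa i , fa⊑b)
            -- `ω` applied to the witnesses has as image their join: it lies above each of them and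
            -- still below `b`. For a constant, the constant of `𝐀` itself is the witness.
            (λ h → A.interp ω (proj₁ ∘ h) ,
              ⊑-interp (λ i → ⊑-trans (proj₁ (proj₂ (h i))) (⊑-arg (⊑-respˡ (F.homo ω _) ⊑-refl) i)) ,
              ⊑-respˡ (sym (F.homo ω _)) (⊑-interp (proj₂ ∘ proj₂ ∘ h)))
          agree : ∀ a → below (F.to a) ⇔ below-image (F.to a)
          agree a = mk⇔ (λ fa⊑b → a , ⊑-refl , fa⊑b) (λ (_ , fa⊑fa′ , fa′⊑b) → ⊑-trans fa⊑fa′ fa′⊑b)

        module _ (y : Carrier 𝐁) (a₀ : Carrier 𝐀) (fa₀⊑y : F.to a₀ ⊑ y) where

          image-fibre whole-fibre : Algebra 𝑆 ℓ
          image-fibre = fibre f y a₀ fa₀⊑y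
          whole-fibre = fibre (idHom 𝐁) y (F.to a₀) fa₀⊑y

          inclusion : Hom image-fibre whole-fibre
          inclusion = record
            { func = record { to = λ (a , fa⊑y) → F.to a , fa⊑y ; cong = id }
            ; homo = λ ω u → ∙-congʳ (F.homo ω _)
            }

          inclusion-epi : IsEpimorphism 𝒱 inclusion
          inclusion-epi 𝐂 𝐂∈𝒱 g₁ g₂ agree (b , b⊑y) =
            proj₂ (f-epi (partialAlgebra y 𝐂) (partialAlgebra∈R 𝐂∈𝒱) (extend g₁) (extend g₂)
              -- `agree` compares the values at the same proof `h`; congruence of `g₂` then passes
              -- to `h′`.
              (λ a → refl , λ h h′ → Algebra.trans 𝐂 (agree (a , h)) (Hom.cong g₂ refl)) b) b⊑y b⊑y

        epi⇒surjective : IsVariety e 𝒱 → EpimorphismSurjectivity 𝒱 → IsSurjective f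
        epi⇒surjective 𝒱-variety 𝒱-es b with image-meets-fibre b
        ... | a₀ , b⊑y , y⊑b with 𝒱-es (image-fibre _ a₀ ⊑-refl) (whole-fibre _ a₀ ⊑-refl)
                                      (fibre∈𝒱 𝒱-variety f ⊑-refl) (fibre∈𝒱 𝒱-variety (idHom 𝐁) ⊑-refl)
                                      (inclusion _ a₀ ⊑-refl) (inclusion-epi _ a₀ ⊑-refl) (b , b⊑y)
        -- The fibre is taken at `f a₀` rather than at `b`, so that multiplication by its base point
        -- lifts to `𝐀`: the preimage is the product of `a` and `a₀`.
        ...   | (a , fa⊑y) , fa≈b = eval 𝐀 (a ∷ a₀ ∷ []) m , λ {z} z≈ → begin
          F.to z                             ≈⟨ F.cong z≈ ⟩
          F.to (eval 𝐀 (a ∷ a₀ ∷ []) m)      ≈⟨ eval-homo 𝐀 𝐁 F.to F.homo m ⟩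
          eval 𝐁 (F.to ∘ (a ∷ a₀ ∷ [])) m    ≈⟨ eval-cong 𝐁 m (λ { zero _ → refl ; (suc zero) _ → refl }) ⟩
          F.to a ∙ F.to a₀                   ≈⟨ fa≈b {a , fa⊑y} refl ⟩
          b ∙ F.to a₀                        ≈⟨ y⊑b ⟩
          b                                  ∎

theorem13 : {o ℓ κ e : Level} (𝑆 : Signature o) (𝒱 : Pred (Algebra 𝑆 ℓ) κ) →
    Plural 𝑆 → IsVariety e 𝒱 → StronglyIrregular 𝒱 →
    EpimorphismSurjectivity 𝒱 → EpimorphismSurjectivity (R 𝒱)
theorem13 𝑆 𝒱 _ 𝒱-variety (m , x∈m , y∈m , 𝒱⊫m≈x) 𝒱-es 𝐀 𝐁 _ 𝐁∈R f f-epi =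
  epi⇒surjective f f-epi 𝒱-variety 𝒱-es
  where open Płonka.Fibres m x∈m y∈m 𝒱⊫m≈x 𝐁 𝐁∈R
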